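{- For integers $0\le a<b$ let $\Delta_3([a,b))$ denote the number of evil integers in $[a,b)$ divisible by $3$ minus the number of odious integers in $[a,b)$ divisible by $3$ (both even and odd integers are counted). Then: 1) For every integer $n\ge 1$: $\Delta_3([0,2^n))=2\cdot 3^{\frac n2-1}$ if $n$ is even, and $\Delta_3([0,2^n))=3^{\frac{n-1}{2}}$ if $n$ is odd. 2) For integers $n,m$: $$\Delta_3([2^n,2^n+2^m))=\begin{cases}3^{\lfloor\frac{m-1}{2}\rfloor}, & n \text{ odd},\ 1\le m\le n-1,\\ 3^{\frac m2-1}, & n \text{ and } m \text{ even},\ 2\le m\le n-2,\\ 0, & n \text{ even},\ m \text{ odd},\ 1\le m\le n-1.\end{cases}$$ 3) For integers $n,m$: $$\Delta_3([2^n+2^{n-2},\,2^n+2^{n-2}+2^m))=\begin{cases}-3^{\lfloor\frac{m-1}{2}\rfloor}, & n \text{ even},\ 1\le m\le n-3,\\ -3^{\frac m2-1}, & n \text{ odd},\ m \text{ even},\ 2\le m\le n-3,\\ 0, & n \text{ and } m \text{ odd},\ 1\le m\le n-4.\end{cases}$$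
   Context: A nonnegative integer is called evil if its binary expansion contains an even number of 1's, and odious if it contains an odd number of 1's; in particular $0$ is evil. An interval $[a,b)$ means the set of integers $x$ with $a\le x<b$. -}

module Defs where

open import Data.Digit using (Expansion; toDigits; 1b)
import Data.Fin.Properties as Fin
open import Data.Integer.Base using (ℤ; +_; _-_)
open import Data.List.Base using (List; filter; length; upTo)
open import Data.Nat.Base using (ℕ)
open import Data.Nat.Divisibility using (_∣_; _∤_; _∣?_)
open import Data.Nat.Properties using (_≤?_)
open import Data.Product.Base using (proj₁)
open import Relation.Nullary.Decidable using (¬?; _×-dec_)
open import Relation.Unary using (Decidable)

Even Odd : ℕ → Set
Even n = 2 ∣ n
Odd  n = 2 ∤ n

even? : Decidable Even
even? n = 2 ∣? n

odd? : Decidable Odd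
odd? n = ¬? (even? n)

binary : ℕ → Expansion 2
binary n = proj₁ (toDigits 2 n)

ones : ℕ → ℕ
ones n = length (filter (Fin._≟ 1b) (binary n))

Evil Odious : ℕ → Set
Evil   n = Even (ones n)
Odious n = Odd  (ones n)

evil? : Decidable Evil
evil? n = even? (ones n)

odious? : Decidable Odious
odious? n = odd? (ones n)

-- The half-open interval [a , b), each element listed once.
interval : ℕ → ℕ → List ℕ
interval a b = filter (a ≤?_) (upTo b)

Δ₃ : ℕ → ℕ → ℤ
Δ₃ a b =
    + length (filter (λ x → evil?   x ×-dec 3 ∣? x) (interval a b))
  - + length (filter (λ x → odious? x ×-dec 3 ∣? x) (interval a b))

{-# OPTIONS --safe #-}
module Submission where

-- Let s(x) = 1 for evil and −1 for odious x, and let S r be the sum of s(x)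
-- over the x in [c·2ᵐ , (c+1)·2ᵐ) with 3 ∣ r + x.  Splitting off the lowest bit
-- gives S r (m+1) = S (2r) m − S (2r+2) m.  The square of this linear map on
-- (S 0 , S 1 , S 2) is 3 times the identity on triples of sum zero, hence
-- S 0 (m+3) = 3 · S 0 (m+1), and S 0 is determined by s(c) and c mod 3.  The
-- intervals in question have c = 0, c = 2ᵏ and c = 5·2ⁱ.

open import Defs
open import Data.Nat.Base using (ℕ; _+_; _*_; _∸_; _^_; _/_; _≤_)
open import Data.Integer.Base using (+_; -_)
open import Data.Product.Base using (_×_)
open import Relation.Binary.PropositionalEquality.Core using (_≡_)
open import Data.Bool.Base using (true; false; if_then_else_)
open import Data.Digit using (Expansion; toDigits; fromDigits; 0b; 1b)
open import Data.Fin.Base using (zero; suc)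
import Data.Fin.Properties as Fin
open import Data.Integer.Base as ℤ using (ℤ; 0ℤ; 1ℤ; -1ℤ)
import Data.Integer.Properties as ℤ
import Data.Integer.Tactic.RingSolver as ℤ-Solver
open import Data.List.Base using (List; []; _∷_; _++_; [_]; filter; length; upTo)
open import Data.List.Properties using (filter-++; filter-none; filter-accept; length-++; upTo-∷ʳ)
open import Data.List.Relation.Unary.All.Properties using (applyUpTo⁺₁)
open import Data.Nat.Base using (zero; suc; z≤n; _%_)
open import Data.Nat.Divisibility using (_∣_; _∣?_; divides; divides-refl; ∣m+n∣m⇒∣n; ∣m∣n⇒∣m+n; m∣m*n)
open import Data.Nat.DivMod using (%-distribˡ-+; %-distribˡ-*; m*n/n≡m; +-distrib-/-∣ʳ)
open import Data.Nat.Properties using (_≟_; _≤?_; +-comm; +-identityʳ; +-suc; *-comm; *-assoc; *-identityʳ; *-cancelʳ-≡; ^-distribˡ-+-*; m≤m+n; m+[n∸m]≡n; ≤-trans; m∸n≤m; <⇒≱; <⇒≤)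
open import Data.Nat.Tactic.RingSolver using (solve-∀)
open import Data.Product.Base using (∃; _,_; proj₁; proj₂)
open import Data.Sum.Base using (_⊎_; inj₁; inj₂)
open import Function.Base using (_∘_; id)
open import Function.Bundles using (mk⇔)
open import Relation.Binary.PropositionalEquality using (refl; sym; trans; cong; cong₂; subst; module ≡-Reasoning)
open import Relation.Nullary using (¬_; Dec; yes; no; contradiction)
open import Relation.Nullary.Decidable using (does; does-⇔; ¬?; _×-dec_)
open import Relation.Unary using (Decidable)

-- Parity of natural numbers.

odd[1+2j] : ∀ j → Odd (1 + j * 2)
odd[1+2j] j d with ∣m+n∣m⇒∣n (subst (2 ∣_) (+-comm 1 (j * 2)) d) (divides-refl j)
... | divides zero ()
... | divides (suc _) ()

even⊎odd : ∀ n → (∃ λ j → n ≡ j * 2) ⊎ (∃ λ j → n ≡ 1 + j * 2)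
even⊎odd zero    = inj₁ (0 , refl)
even⊎odd (suc n) with even⊎odd n
... | inj₁ (j , refl) = inj₂ (j , refl)
... | inj₂ (j , refl) = inj₁ (suc j , refl)

odd⇒1+2j : ∀ {n} → Odd n → ∃ λ j → n ≡ 1 + j * 2
odd⇒1+2j {n} o with even⊎odd n
... | inj₁ (j , eq) = contradiction (divides j eq) o
... | inj₂ p        = p

even⇒2+2j : ∀ {n} → 1 ≤ n → Even n → ∃ λ j → n ≡ 2 + j * 2
even⇒2+2j 1≤n (divides (suc j) eq) = j , eq
even⇒2+2j ()  (divides-refl zero)

odd⇒even-suc : ∀ {n} → Odd n → Even (suc n)
odd⇒even-suc o with odd⇒1+2j o
... | j , refl = divides-refl (suc j)

even+⇒even : ∀ m {n} → Even (m + n) → Even m → Even n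
even+⇒even m = ∣m+n∣m⇒∣n

even+⇒odd : ∀ m {n} → Even (m + n) → Odd m → Odd n
even+⇒odd m {n} e o e′ = o (∣m+n∣m⇒∣n (subst Even (+-comm m n) e) e′)

odd+⇒odd : ∀ m {n} → Odd (m + n) → Even m → Odd n
odd+⇒odd m o e e′ = o (∣m∣n⇒∣m+n e e′)

odd+⇒even : ∀ m {n} → Odd (m + n) → Odd m → Even n
-- `suc (m + n)` is `suc m + n` by computation, so adding 1 turns both odd numbers even.
odd+⇒even m {n} o o′ = even+⇒even (suc m) (odd⇒even-suc o) (odd⇒even-suc o′)

-- Binary digit counts and the evil/odious sign.

-- The expansion of a number is unique only up to most significant zeros,
-- which do not contribute to the count.
fromDigits⇒count : ∀ (ds es : Expansion 2) → fromDigits ds ≡ fromDigits es →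
                   length (filter (Fin._≟ 1b) ds) ≡ length (filter (Fin._≟ 1b) es)
fromDigits⇒count [] [] _ = refl
fromDigits⇒count [] (zero ∷ es) eq = fromDigits⇒count [] es (*-cancelʳ-≡ 0 (fromDigits es) 2 eq)
fromDigits⇒count [] (suc zero ∷ es) ()
fromDigits⇒count (zero ∷ ds) [] eq = fromDigits⇒count ds [] (*-cancelʳ-≡ (fromDigits ds) 0 2 eq)
fromDigits⇒count (suc zero ∷ ds) [] ()
fromDigits⇒count (zero ∷ ds) (zero ∷ es) eq =
  fromDigits⇒count ds es (*-cancelʳ-≡ (fromDigits ds) (fromDigits es) 2 eq)
fromDigits⇒count (zero ∷ ds) (suc zero ∷ es) eq =
  contradiction (divides (fromDigits ds) (sym eq)) (odd[1+2j] (fromDigits es))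
fromDigits⇒count (suc zero ∷ ds) (zero ∷ es) eq =
  contradiction (divides (fromDigits es) eq) (odd[1+2j] (fromDigits ds))
fromDigits⇒count (suc zero ∷ ds) (suc zero ∷ es) eq =
  cong suc (fromDigits⇒count ds es (*-cancelʳ-≡ (fromDigits ds) (fromDigits es) 2 (cong (_∸ 1) eq)))

ones-cons : ∀ d x → ones (fromDigits (d ∷ binary x)) ≡ length (filter (Fin._≟ 1b) (d ∷ binary x))
ones-cons d x = fromDigits⇒count (binary (fromDigits (d ∷ binary x))) (d ∷ binary x) (proj₂ (toDigits 2 (fromDigits (d ∷ binary x))))

-- The left side is what `fromDigits (0b ∷ binary x)` reduces to, which lets `ones-cons` apply to
-- `2 * x` and, under `suc`, to `1 + 2 * x`.
fromDigits-binary : ∀ x → fromDigits (binary x) * 2 ≡ 2 * x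
fromDigits-binary x = trans (cong (_* 2) (proj₂ (toDigits 2 x))) (*-comm x 2)

ones-2x : ∀ x → ones (2 * x) ≡ ones x
ones-2x x = trans (cong ones (sym (fromDigits-binary x))) (ones-cons 0b x)

ones-1+2x : ∀ x → ones (1 + 2 * x) ≡ suc (ones x)
ones-1+2x x = trans (cong (ones ∘ suc) (sym (fromDigits-binary x))) (ones-cons 1b x)

-- The Thue-Morse sequence with values 1 and -1.
sgn : ℕ → ℤ
sgn x = -1ℤ ℤ.^ ones x

sgn-2x : ∀ x → sgn (2 * x) ≡ sgn x
sgn-2x x = cong (-1ℤ ℤ.^_) (ones-2x x)

sgn-1+2x : ∀ x → sgn (1 + 2 * x) ≡ - sgn x
sgn-1+2x x = trans (cong (-1ℤ ℤ.^_) (ones-1+2x x)) (ℤ.-1*i≡-i (sgn x))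

m*[2*n]≡2*[m*n] : ∀ m n → m * (2 * n) ≡ 2 * (m * n)
m*[2*n]≡2*[m*n] = solve-∀

sgn-*2^ : ∀ c k → sgn (c * 2 ^ k) ≡ sgn c
sgn-*2^ c zero    = cong sgn (*-identityʳ c)
sgn-*2^ c (suc k) = begin
  sgn (c * (2 * 2 ^ k)) ≡⟨ cong sgn (m*[2*n]≡2*[m*n] c (2 ^ k)) ⟩
  sgn (2 * (c * 2 ^ k)) ≡⟨ sgn-2x (c * 2 ^ k) ⟩
  sgn (c * 2 ^ k)       ≡⟨ sgn-*2^ c k ⟩
  sgn c                 ∎
  where open ≡-Reasoning

[-1]^even : ∀ {n} → Even n → -1ℤ ℤ.^ n ≡ 1ℤ
[-1]^even (divides-refl zero)    = refl
[-1]^even (divides-refl (suc j)) = cong (λ z → -1ℤ ℤ.* (-1ℤ ℤ.* z)) ([-1]^even (divides-refl j))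

[-1]^odd : ∀ {n} → Odd n → -1ℤ ℤ.^ n ≡ -1ℤ
[-1]^odd o with odd⇒1+2j o
... | j , refl = cong (-1ℤ ℤ.*_) ([-1]^even (divides-refl j))

-- Divisibility by 3 and the signed summand.

ind : ℕ → ℤ
ind n = if does (3 ∣? n) then 1ℤ else 0ℤ

ind-⇔ : ∀ m n → (3 ∣ m → 3 ∣ n) → (3 ∣ n → 3 ∣ m) → ind m ≡ ind n
ind-⇔ m n f g = cong (if_then 1ℤ else 0ℤ) (does-⇔ (mk⇔ f g) (3 ∣? m) (3 ∣? n))

ind-complement : ∀ m n k → m + n ≡ 3 * k → ind m ≡ ind n
ind-complement m n k eq =
  ind-⇔ m n (∣m+n∣m⇒∣n 3∣m+n) (∣m+n∣m⇒∣n (subst (3 ∣_) (+-comm m n) 3∣m+n))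
  where
  3∣m+n : 3 ∣ m + n
  3∣m+n = subst (3 ∣_) (sym eq) (m∣m*n k)

ind-3+ : ∀ n → ind (3 + n) ≡ ind n
ind-3+ n = ind-⇔ (3 + n) n (λ d → ∣m+n∣m⇒∣n d (divides-refl 1)) (∣m∣n⇒∣m+n (divides-refl 1))

ind-% : ∀ m n → m % 3 ≡ n % 3 → ind m ≡ ind n
-- `does (3 ∣? n)` unfolds to `does (n % 3 ≟ 0)`, so `ind` depends on the remainder by computation.
ind-% m n eq = cong (λ k → if does (k ≟ 0) then 1ℤ else 0ℤ) eq

-- The shift `r` makes the family closed under splitting off the lowest bit, which moves the residue
-- class being tested.
χ : ℕ → ℕ → ℤ
χ r x = ind (r + x) ℤ.* sgn x

χ-3+ : ∀ r x → χ (3 + r) x ≡ χ r x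
χ-3+ r x = cong (ℤ._* sgn x) (ind-3+ (r + x))

-- As 2 ≡ -1 modulo 3, `r + 2 * x` is the negative of `2 * r + x`, and `r + (1 + 2 * x)` that of
-- `2 + 2 * r + x`; a number and its negative are divisible by 3 together. The minus sign comes from
-- the extra bit 1.
χ-double : ∀ r x → χ r (2 * x) ℤ.+ χ r (1 + 2 * x) ≡ χ (2 * r) x ℤ.- χ (2 + 2 * r) x
χ-double r x = cong₂ ℤ._+_
  (cong₂ ℤ._*_ (ind-complement (r + 2 * x) (2 * r + x) (r + x) (eq₀ r x)) (sgn-2x x))
  (trans (cong₂ ℤ._*_ (ind-complement (r + (1 + 2 * x)) (2 + 2 * r + x) (1 + r + x) (eq₁ r x)) (sgn-1+2x x))
         (sym (ℤ.neg-distribʳ-* (ind (2 + 2 * r + x)) (sgn x))))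
  where
  eq₀ : ∀ r x → (r + 2 * x) + (2 * r + x) ≡ 3 * (r + x)
  eq₀ = solve-∀
  eq₁ : ∀ r x → (r + (1 + 2 * x)) + (2 + 2 * r + x) ≡ 3 * (1 + r + x)
  eq₁ = solve-∀

-- From counting in intervals to signed sums.

-- `Δ₃ a b` is `imbalance (interval a b)` by definition; for arbitrary lists the difference is
-- additive under `_++_`.
imbalance : List ℕ → ℤ
imbalance xs =
    + length (filter (λ x → evil?   x ×-dec 3 ∣? x) xs)
  ℤ.- + length (filter (λ x → odious? x ×-dec 3 ∣? x) xs)

length-filter-++ : ∀ {P : ℕ → Set} (P? : Decidable P) xs ys →
                   + length (filter P? (xs ++ ys)) ≡ + length (filter P? xs) ℤ.+ + length (filter P? ys)
length-filter-++ P? xs ys = begin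
  + length (filter P? (xs ++ ys))                     ≡⟨ cong (+_ ∘ length) (filter-++ P? xs ys) ⟩
  + length (filter P? xs ++ filter P? ys)             ≡⟨ cong +_ (length-++ (filter P? xs)) ⟩
  + (length (filter P? xs) + length (filter P? ys))   ≡⟨ ℤ.pos-+ (length (filter P? xs)) _ ⟩
  + length (filter P? xs) ℤ.+ + length (filter P? ys) ∎
  where open ≡-Reasoning

imbalance-++ : ∀ xs ys → imbalance (xs ++ ys) ≡ imbalance xs ℤ.+ imbalance ys
imbalance-++ xs ys = trans
  (cong₂ ℤ._-_ (length-filter-++ (λ x → evil?   x ×-dec 3 ∣? x) xs ys)
               (length-filter-++ (λ x → odious? x ×-dec 3 ∣? x) xs ys))
  (interchange (+ length (filter (λ x → evil?   x ×-dec 3 ∣? x) xs))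
               (+ length (filter (λ x → evil?   x ×-dec 3 ∣? x) ys))
               (+ length (filter (λ x → odious? x ×-dec 3 ∣? x) xs))
               (+ length (filter (λ x → odious? x ×-dec 3 ∣? x) ys)))
  where
  interchange : ∀ a b c d → (a ℤ.+ b) ℤ.- (c ℤ.+ d) ≡ (a ℤ.- c) ℤ.+ (b ℤ.- d)
  interchange = ℤ-Solver.solve-∀

length-filter-[x] : ∀ {P : ℕ → Set} (P? : Decidable P) x →
                    length (filter P? [ x ]) ≡ (if does (P? x) then 1 else 0)
length-filter-[x] P? x with does (P? x)
... | true  = refl
... | false = refl

imbalance-[x] : ∀ x → imbalance [ x ] ≡ χ 0 x
imbalance-[x] x = trans
  (cong₂ (λ a b → + a ℤ.- + b) (length-filter-[x] (λ y → evil?   y ×-dec 3 ∣? y) x)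
                               (length-filter-[x] (λ y → odious? y ×-dec 3 ∣? y) x))
  -- With both decisions and the sign abstracted, the four cases compute without unfolding `ones`.
  (signed (evil? x) (3 ∣? x) [-1]^even [-1]^odd)
  where
  signed : ∀ {P Q : Set} (p : Dec P) (q : Dec Q) {s} → (P → s ≡ 1ℤ) → (¬ P → s ≡ -1ℤ) →
           + (if does (p ×-dec q) then 1 else 0) ℤ.- + (if does (¬? p ×-dec q) then 1 else 0)
           ≡ (if does q then 1ℤ else 0ℤ) ℤ.* s
  signed (yes p) (yes _) f _ = cong (1ℤ ℤ.*_) (sym (f p))
  signed (yes _) (no _)  _ _ = refl
  signed (no ¬p) (yes _) _ g = cong (1ℤ ℤ.*_) (sym (g ¬p))
  signed (no _)  (no _)  _ _ = refl

-- Indexed by length and extended on the right, just as `interval` grows with its upper end.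
window : (ℕ → ℤ) → ℕ → ℕ → ℤ
window f a zero    = 0ℤ
window f a (suc k) = window f a k ℤ.+ f (a + k)

interval-empty : ∀ a → interval a a ≡ []
interval-empty a = filter-none (a ≤?_) (applyUpTo⁺₁ id a <⇒≱)

interval-suc : ∀ {a b} → a ≤ b → interval a (suc b) ≡ interval a b ++ [ b ]
interval-suc {a} {b} a≤b = begin
  interval a (suc b)                    ≡⟨ cong (filter (a ≤?_)) (upTo-∷ʳ b) ⟨
  filter (a ≤?_) (upTo b ++ [ b ])      ≡⟨ filter-++ (a ≤?_) (upTo b) [ b ] ⟩
  interval a b ++ filter (a ≤?_) [ b ]  ≡⟨ cong (interval a b ++_) (filter-accept (a ≤?_) a≤b) ⟩
  interval a b ++ [ b ]                 ∎
  where open ≡-Reasoning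

Δ₃-window : ∀ a k → Δ₃ a (a + k) ≡ window (χ 0) a k
Δ₃-window a zero    = cong imbalance (trans (cong (interval a) (+-identityʳ a)) (interval-empty a))
Δ₃-window a (suc k) = begin
  imbalance (interval a (a + suc k))                     ≡⟨ cong (imbalance ∘ interval a) (+-suc a k) ⟩
  imbalance (interval a (suc (a + k)))                   ≡⟨ cong imbalance (interval-suc (m≤m+n a k)) ⟩
  imbalance (interval a (a + k) ++ [ a + k ])            ≡⟨ imbalance-++ (interval a (a + k)) [ a + k ] ⟩
  imbalance (interval a (a + k)) ℤ.+ imbalance [ a + k ] ≡⟨ cong₂ ℤ._+_ (Δ₃-window a k) (imbalance-[x] (a + k)) ⟩
  window (χ 0) a k ℤ.+ χ 0 (a + k)                       ∎
  where open ≡-Reasoning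

window-cong : ∀ {f g} → (∀ x → f x ≡ g x) → ∀ a k → window f a k ≡ window g a k
window-cong eq a zero    = refl
window-cong eq a (suc k) = cong₂ ℤ._+_ (window-cong eq a k) (eq (a + k))

window-- : ∀ f g a k → window (λ x → f x ℤ.- g x) a k ≡ window f a k ℤ.- window g a k
window-- f g a zero    = refl
window-- f g a (suc k) = trans (cong (ℤ._+ (f (a + k) ℤ.- g (a + k))) (window-- f g a k))
  (interchange (window f a k) (window g a k) (f (a + k)) (g (a + k)))
  where
  interchange : ∀ a b c d → (a ℤ.- b) ℤ.+ (c ℤ.- d) ≡ (a ℤ.+ c) ℤ.- (b ℤ.+ d)
  interchange = ℤ-Solver.solve-∀

window-double : ∀ f a k → window f (2 * a) (2 * k) ≡ window (λ x → f (2 * x) ℤ.+ f (1 + 2 * x)) a k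
window-double f a zero    = refl
window-double f a (suc k) = begin
  window f (2 * a) (2 * suc k)
    ≡⟨ cong (window f (2 * a)) (2*[1+k] k) ⟩
  window f (2 * a) (2 * k) ℤ.+ f (2 * a + 2 * k) ℤ.+ f (2 * a + suc (2 * k))
    ≡⟨ ℤ.+-assoc (window f (2 * a) (2 * k)) _ _ ⟩
  window f (2 * a) (2 * k) ℤ.+ (f (2 * a + 2 * k) ℤ.+ f (2 * a + suc (2 * k)))
    ≡⟨ cong₂ ℤ._+_ (window-double f a k) (cong₂ (λ x y → f x ℤ.+ f y) (eq₀ a k) (eq₁ a k)) ⟩
  window (λ x → f (2 * x) ℤ.+ f (1 + 2 * x)) a (suc k) ∎
  where
  open ≡-Reasoning
  2*[1+k] : ∀ k → 2 * suc k ≡ suc (suc (2 * k))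
  2*[1+k] = solve-∀
  eq₀ : ∀ a k → 2 * a + 2 * k ≡ 2 * (a + k)
  eq₀ = solve-∀
  eq₁ : ∀ a k → 2 * a + suc (2 * k) ≡ 1 + 2 * (a + k)
  eq₁ = solve-∀

-- Recurrences for sums over dyadic blocks.

module Block (c : ℕ) where

  S : ℕ → ℕ → ℤ
  S r m = window (χ r) (c * 2 ^ m) (2 ^ m)

  S-zero : ∀ r → S r 0 ≡ χ r c
  S-zero r = trans (ℤ.+-identityˡ _) (cong (χ r) (trans (+-identityʳ (c * 1)) (*-identityʳ c)))

  S-3+ : ∀ r m → S (3 + r) m ≡ S r m
  S-3+ r m = window-cong (χ-3+ r) (c * 2 ^ m) (2 ^ m)

  S-suc : ∀ r m → S r (suc m) ≡ S (2 * r) m ℤ.- S (2 + 2 * r) m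
  S-suc r m = begin
    window (χ r) (c * (2 * p)) (2 * p)
      ≡⟨ cong (λ a → window (χ r) a (2 * p)) (m*[2*n]≡2*[m*n] c p) ⟩
    window (χ r) (2 * (c * p)) (2 * p)
      ≡⟨ window-double (χ r) (c * p) p ⟩
    window (λ x → χ r (2 * x) ℤ.+ χ r (1 + 2 * x)) (c * p) p
      ≡⟨ window-cong (χ-double r) (c * p) p ⟩
    window (λ x → χ (2 * r) x ℤ.- χ (2 + 2 * r) x) (c * p) p
      ≡⟨ window-- (χ (2 * r)) (χ (2 + 2 * r)) (c * p) p ⟩
    S (2 * r) m ℤ.- S (2 + 2 * r) m ∎
    where
    open ≡-Reasoning
    p = 2 ^ m

  -- The indices 4 and 6 produced by `S-suc` are reduced by period 3, which closes the system on
  -- `S 0`, `S 1`, `S 2`.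
  S₁-suc : ∀ m → S 1 (suc m) ≡ S 2 m ℤ.- S 1 m
  S₁-suc m = trans (S-suc 1 m) (cong (λ z → S 2 m ℤ.- z) (S-3+ 1 m))

  S₂-suc : ∀ m → S 2 (suc m) ≡ S 1 m ℤ.- S 0 m
  S₂-suc m = trans (S-suc 2 m)
    (cong₂ ℤ._-_ (S-3+ 1 m) (trans (S-3+ 3 m) (S-3+ 0 m)))

  -- The right side is 3 times `S 0 m` minus the total of all three sums, so two steps triple `S 0`
  -- whenever that total vanishes.
  S₀-2+ : ∀ m → S 0 (2 + m) ≡ + 2 ℤ.* S 0 m ℤ.- S 1 m ℤ.- S 2 m
  S₀-2+ m = trans (S-suc 0 (suc m))
    (trans (cong₂ ℤ._-_ (S-suc 0 m) (S₂-suc m)) (eq (S 0 m) (S 1 m) (S 2 m)))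
    where
    eq : ∀ x y z → (x ℤ.- z) ℤ.- (y ℤ.- x) ≡ + 2 ℤ.* x ℤ.- y ℤ.- z
    eq = ℤ-Solver.solve-∀

  -- After one step the three sums are cyclic differences of the previous ones, so their total is 0.
  -- This is why tripling starts from `1 + m` rather than from `m`.
  S₀-3+ : ∀ m → S 0 (3 + m) ≡ + 3 ℤ.* S 0 (1 + m)
  S₀-3+ m = begin
    S 0 (3 + m)
      ≡⟨ S₀-2+ (suc m) ⟩
    + 2 ℤ.* S 0 (suc m) ℤ.- S 1 (suc m) ℤ.- S 2 (suc m)
      ≡⟨ cong₂ (λ y z → + 2 ℤ.* S 0 (suc m) ℤ.- y ℤ.- z) (S₁-suc m) (S₂-suc m) ⟩
    + 2 ℤ.* S 0 (suc m) ℤ.- (S 2 m ℤ.- S 1 m) ℤ.- (S 1 m ℤ.- S 0 m)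
      ≡⟨ cong (λ x → + 2 ℤ.* x ℤ.- (S 2 m ℤ.- S 1 m) ℤ.- (S 1 m ℤ.- S 0 m)) (S-suc 0 m) ⟩
    + 2 ℤ.* (S 0 m ℤ.- S 2 m) ℤ.- (S 2 m ℤ.- S 1 m) ℤ.- (S 1 m ℤ.- S 0 m)
      ≡⟨ eq (S 0 m) (S 1 m) (S 2 m) ⟩
    + 3 ℤ.* (S 0 m ℤ.- S 2 m)
      ≡⟨ cong (+ 3 ℤ.*_) (S-suc 0 m) ⟨
    + 3 ℤ.* S 0 (suc m) ∎
    where
    open ≡-Reasoning
    eq : ∀ x y z → + 2 ℤ.* (x ℤ.- z) ℤ.- (z ℤ.- y) ℤ.- (y ℤ.- x) ≡ + 3 ℤ.* (x ℤ.- z)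
    eq = ℤ-Solver.solve-∀

  -- Taking `m` as 0 or 1 covers the odd and the positive even exponents.
  S₀-geometric : ∀ m j → S 0 (1 + m + j * 2) ≡ S 0 (1 + m) ℤ.* + (3 ^ j)
  S₀-geometric m zero    = trans (cong (S 0) (+-identityʳ (1 + m))) (sym (ℤ.*-identityʳ _))
  S₀-geometric m (suc j) = begin
    S 0 (1 + m + (2 + j * 2))           ≡⟨ cong (S 0) (eq m (j * 2)) ⟩
    S 0 (3 + (m + j * 2))               ≡⟨ S₀-3+ (m + j * 2) ⟩
    + 3 ℤ.* S 0 (1 + m + j * 2)         ≡⟨ cong (+ 3 ℤ.*_) (S₀-geometric m j) ⟩
    + 3 ℤ.* (S 0 (1 + m) ℤ.* + (3 ^ j)) ≡⟨ eq′ (S 0 (1 + m)) (+ (3 ^ j)) ⟩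
    S 0 (1 + m) ℤ.* (+ 3 ℤ.* + (3 ^ j)) ≡⟨ cong (S 0 (1 + m) ℤ.*_) (ℤ.pos-* 3 (3 ^ j)) ⟨
    S 0 (1 + m) ℤ.* + (3 ^ suc j)       ∎
    where
    open ≡-Reasoning
    eq : ∀ m k → 1 + m + (2 + k) ≡ 3 + (m + k)
    eq = solve-∀
    eq′ : ∀ x y → + 3 ℤ.* (x ℤ.* y) ≡ x ℤ.* (+ 3 ℤ.* y)
    eq′ = ℤ-Solver.solve-∀

-- Block values in terms of sign and residue.

χ-% : ∀ r c t → c % 3 ≡ t % 3 → χ r c ≡ ind (r + t) ℤ.* sgn c
χ-% r c t c≡t = cong (ℤ._* sgn c)
  (ind-% (r + c) (r + t) (trans (%-distribˡ-+ r c 3)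
         (trans (cong (λ z → (r % 3 + z) % 3) c≡t) (sym (%-distribˡ-+ r t 3)))))

Δ₃-block : ℕ → ℕ → ℤ
Δ₃-block c m = Δ₃ (c * 2 ^ m) (c * 2 ^ m + 2 ^ m)

-- At level 0 each sum has the single term at `c`. A literal residue `t` in place of `c` lets
-- `ind t` and its neighbours evaluate.
Δ₃-block-odd : ∀ c t j → c % 3 ≡ t % 3 →
  Δ₃-block c (1 + j * 2) ≡ (ind t ℤ.* sgn c ℤ.- ind (2 + t) ℤ.* sgn c) ℤ.* + (3 ^ j)
Δ₃-block-odd c t j c≡t = begin
  Δ₃-block c (1 + j * 2)              ≡⟨ Δ₃-window (c * 2 ^ (1 + j * 2)) (2 ^ (1 + j * 2)) ⟩
  S 0 (1 + j * 2)                     ≡⟨ S₀-geometric 0 j ⟩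
  S 0 1 ℤ.* + (3 ^ j)                 ≡⟨ cong (ℤ._* + (3 ^ j)) (S-suc 0 0) ⟩
  (S 0 0 ℤ.- S 2 0) ℤ.* + (3 ^ j)     ≡⟨ cong₂ (λ x z → (x ℤ.- z) ℤ.* + (3 ^ j)) (initial 0) (initial 2) ⟩
  (ind t ℤ.* sgn c ℤ.- ind (2 + t) ℤ.* sgn c) ℤ.* + (3 ^ j) ∎
  where
  open ≡-Reasoning
  open Block c
  initial : ∀ r → S r 0 ≡ ind (r + t) ℤ.* sgn c
  initial r = trans (S-zero r) (χ-% r c t c≡t)

Δ₃-block-even : ∀ c t j → c % 3 ≡ t % 3 →
  Δ₃-block c (2 + j * 2) ≡
  (+ 2 ℤ.* (ind t ℤ.* sgn c) ℤ.- ind (1 + t) ℤ.* sgn c ℤ.- ind (2 + t) ℤ.* sgn c) ℤ.* + (3 ^ j)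
Δ₃-block-even c t j c≡t = begin
  Δ₃-block c (2 + j * 2)
    ≡⟨ Δ₃-window (c * 2 ^ (2 + j * 2)) (2 ^ (2 + j * 2)) ⟩
  S 0 (2 + j * 2)
    ≡⟨ S₀-geometric 1 j ⟩
  S 0 2 ℤ.* + (3 ^ j)
    ≡⟨ cong (ℤ._* + (3 ^ j)) (S₀-2+ 0) ⟩
  (+ 2 ℤ.* S 0 0 ℤ.- S 1 0 ℤ.- S 2 0) ℤ.* + (3 ^ j)
    ≡⟨ cong (λ x → (+ 2 ℤ.* x ℤ.- S 1 0 ℤ.- S 2 0) ℤ.* + (3 ^ j)) (initial 0) ⟩
  (+ 2 ℤ.* (ind t ℤ.* sgn c) ℤ.- S 1 0 ℤ.- S 2 0) ℤ.* + (3 ^ j)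
    ≡⟨ cong₂ (λ y z → (+ 2 ℤ.* (ind t ℤ.* sgn c) ℤ.- y ℤ.- z) ℤ.* + (3 ^ j)) (initial 1) (initial 2) ⟩
  (+ 2 ℤ.* (ind t ℤ.* sgn c) ℤ.- ind (1 + t) ℤ.* sgn c ℤ.- ind (2 + t) ℤ.* sgn c) ℤ.* + (3 ^ j) ∎
  where
  open ≡-Reasoning
  open Block c
  initial : ∀ r → S r 0 ≡ ind (r + t) ℤ.* sgn c
  initial r = trans (S-zero r) (χ-% r c t c≡t)

[1+2j]/2 : ∀ j → (1 + j * 2) / 2 ≡ j
[1+2j]/2 j = trans (+-distrib-/-∣ʳ 1 {j * 2} {2} (divides-refl j)) (m*n/n≡m j 2)

[2+2j]/2∸1 : ∀ j → (2 + j * 2) / 2 ∸ 1 ≡ j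
[2+2j]/2∸1 j = cong (_∸ 1) (m*n/n≡m (suc j) 2)

-- For even `m` the two exponents of the theorem agree, so the block lemmas can use the floor form
-- for both parities.
even⇒[m∸1]/2≡m/2∸1 : ∀ {m} → 1 ≤ m → Even m → (m ∸ 1) / 2 ≡ m / 2 ∸ 1
even⇒[m∸1]/2≡m/2∸1 1≤m e with even⇒2+2j 1≤m e
... | j , refl = trans ([1+2j]/2 j) (sym ([2+2j]/2∸1 j))

Δ₃-block-odd₁ : ∀ c {m} → Odd m → c % 3 ≡ 1 → Δ₃-block c m ≡ - sgn c ℤ.* + (3 ^ ((m ∸ 1) / 2))
Δ₃-block-odd₁ c o c≡1 with odd⇒1+2j o
... | j , refl = trans (Δ₃-block-odd c 1 j c≡1)
  (cong₂ (λ x e → x ℤ.* + (3 ^ e)) (eq (sgn c)) (sym (m*n/n≡m j 2)))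
  where
  eq : ∀ s → 0ℤ ℤ.* s ℤ.- 1ℤ ℤ.* s ≡ - s
  eq = ℤ-Solver.solve-∀

-- For residue 2 the relevant indicators are at 2 and 4, neither divisible by 3, so both starting
-- terms vanish.
Δ₃-block-odd₂ : ∀ c {m} → Odd m → c % 3 ≡ 2 → Δ₃-block c m ≡ 0ℤ
Δ₃-block-odd₂ c o c≡2 with odd⇒1+2j o
... | j , refl = trans (Δ₃-block-odd c 2 j c≡2) (cong (ℤ._* + (3 ^ j)) (ℤ.+-inverseʳ (0ℤ ℤ.* sgn c)))

-- For either nonzero residue `t`, exactly one of `1 + t` and `2 + t` is divisible by 3. Both carry
-- the coefficient -1, hence the common value.
Δ₃-block-even₁₂ : ∀ c {m} → 1 ≤ m → Even m → c % 3 ≡ 1 ⊎ c % 3 ≡ 2 →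
                  Δ₃-block c m ≡ - sgn c ℤ.* + (3 ^ ((m ∸ 1) / 2))
Δ₃-block-even₁₂ c 1≤m e c≡t with even⇒2+2j 1≤m e
Δ₃-block-even₁₂ c 1≤m e (inj₁ c≡1) | j , refl = trans (Δ₃-block-even c 1 j c≡1)
  (cong₂ (λ x e → x ℤ.* + (3 ^ e)) (eq (sgn c)) (sym ([1+2j]/2 j)))
  where
  eq : ∀ s → + 2 ℤ.* (0ℤ ℤ.* s) ℤ.- 0ℤ ℤ.* s ℤ.- 1ℤ ℤ.* s ≡ - s
  eq = ℤ-Solver.solve-∀
Δ₃-block-even₁₂ c 1≤m e (inj₂ c≡2) | j , refl = trans (Δ₃-block-even c 2 j c≡2)
  (cong₂ (λ x e → x ℤ.* + (3 ^ e)) (eq (sgn c)) (sym ([1+2j]/2 j)))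
  where
  eq : ∀ s → + 2 ℤ.* (0ℤ ℤ.* s) ℤ.- 1ℤ ℤ.* s ℤ.- 0ℤ ℤ.* s ≡ - s
  eq = ℤ-Solver.solve-∀

-- Residues and signs of the block indices.

2^even%3 : ∀ {k} → Even k → 2 ^ k % 3 ≡ 1
2^even%3 (divides-refl zero)    = refl
2^even%3 (divides-refl (suc j)) = begin
  2 * (2 * 2 ^ (j * 2)) % 3   ≡⟨ cong (_% 3) (*-assoc 2 2 (2 ^ (j * 2))) ⟨
  4 * 2 ^ (j * 2) % 3         ≡⟨ %-distribˡ-* 4 (2 ^ (j * 2)) 3 ⟩
  1 * (2 ^ (j * 2) % 3) % 3   ≡⟨ cong (λ z → 1 * z % 3) (2^even%3 (divides-refl j)) ⟩
  1                           ∎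
  where open ≡-Reasoning

2^odd%3 : ∀ {k} → Odd k → 2 ^ k % 3 ≡ 2
2^odd%3 o with odd⇒1+2j o
... | j , refl = trans (%-distribˡ-* 2 (2 ^ (j * 2)) 3)
                       (cong (λ z → 2 * z % 3) (2^even%3 {j * 2} (divides-refl j)))

5*n%3 : ∀ n {t} → n % 3 ≡ t → 5 * n % 3 ≡ 2 * t % 3
5*n%3 n eq = trans (%-distribˡ-* 5 n 3) (cong (λ z → 2 * z % 3) eq)

sgn-2^ : ∀ k → sgn (2 ^ k) ≡ -1ℤ
sgn-2^ k = trans (cong sgn (sym (+-identityʳ (2 ^ k)))) (sgn-*2^ 1 k)

-- Initial intervals.

Δ₃-initial-even : ∀ {n} → 1 ≤ n → Even n → Δ₃ 0 (2 ^ n) ≡ + (2 * 3 ^ (n / 2 ∸ 1))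
Δ₃-initial-even 1≤n e with even⇒2+2j 1≤n e
... | j , refl = begin
  -- The interval is the block with `c` = 0 by computation. As 0 is evil and only `ind 0` is
  -- nonzero, the coefficient is 2·1 - 0 - 0 = 2.
  Δ₃-block 0 (2 + j * 2)            ≡⟨ Δ₃-block-even 0 0 j refl ⟩
  + 2 ℤ.* + (3 ^ j)                 ≡⟨ ℤ.pos-* 2 (3 ^ j) ⟨
  + (2 * 3 ^ j)                     ≡⟨ cong (λ e → + (2 * 3 ^ e)) ([2+2j]/2∸1 j) ⟨
  + (2 * 3 ^ ((2 + j * 2) / 2 ∸ 1)) ∎
  where open ≡-Reasoning

Δ₃-initial-odd : ∀ {n} → Odd n → Δ₃ 0 (2 ^ n) ≡ + (3 ^ ((n ∸ 1) / 2))
Δ₃-initial-odd o with odd⇒1+2j o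
... | j , refl = begin
  -- Here the coefficient is 1 - 0 = 1.
  Δ₃-block 0 (1 + j * 2) ≡⟨ Δ₃-block-odd 0 0 j refl ⟩
  1ℤ ℤ.* + (3 ^ j)       ≡⟨ ℤ.*-identityˡ (+ (3 ^ j)) ⟩
  + (3 ^ j)              ≡⟨ cong (λ e → + (3 ^ e)) (m*n/n≡m j 2) ⟨
  + (3 ^ (j * 2 / 2))    ∎
  where open ≡-Reasoning

-- Intervals starting at a power of 2 or at 5 times one.

2^[m+k] : ∀ m k → 2 ^ (m + k) ≡ 2 ^ k * 2 ^ m
2^[m+k] m k = trans (^-distribˡ-+-* 2 m k) (*-comm (2 ^ m) (2 ^ k))

2^[2+m+i]+2^[m+i] : ∀ m i → 2 ^ (2 + (m + i)) + 2 ^ (m + i) ≡ 5 * 2 ^ i * 2 ^ m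
2^[2+m+i]+2^[m+i] m i = trans (cong (λ x → 2 * (2 * x) + x) (2^[m+k] m i)) (eq (2 ^ i) (2 ^ m))
  where
  eq : ∀ x y → 2 * (2 * (x * y)) + x * y ≡ 5 * x * y
  eq = solve-∀

Δ₃≡block : ∀ {a} c m → a ≡ c * 2 ^ m → Δ₃ a (a + 2 ^ m) ≡ Δ₃-block c m
Δ₃≡block c m = cong (λ a → Δ₃ a (a + 2 ^ m))

-- A power of 2 has a single 1 in binary, so it is odious.
-sgn[2^k]* : ∀ k x → - sgn (2 ^ k) ℤ.* x ≡ x
-sgn[2^k]* k x = trans (cong (λ s → - s ℤ.* x) (sgn-2^ k)) (ℤ.*-identityˡ x)

-- 5 is 101 in binary, so its multiples by powers of 2 are evil; hence the negative values in the
-- third part of the theorem.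
-sgn[5*2^i]* : ∀ i x → - sgn (5 * 2 ^ i) ℤ.* x ≡ - x
-sgn[5*2^i]* i x = trans (cong (λ s → - s ℤ.* x) (sgn-*2^ 5 i)) (ℤ.-1*i≡-i x)

module _ (m k : ℕ) where

  private
    shift : Δ₃ (2 ^ (m + k)) (2 ^ (m + k) + 2 ^ m) ≡ Δ₃-block (2 ^ k) m
    shift = Δ₃≡block (2 ^ k) m (2^[m+k] m k)

  -- `m` and `k` have opposite parity: either `m` is even and `2 ^ k` has residue 2, or `m` is odd
  -- and the residue is 1. The two give the same value.
  Δ₃-2^-odd : Odd (m + k) → 1 ≤ m →
    Δ₃ (2 ^ (m + k)) (2 ^ (m + k) + 2 ^ m) ≡ + (3 ^ ((m ∸ 1) / 2))
  Δ₃-2^-odd on 1≤m = trans shift (trans (value (even? m)) (-sgn[2^k]* k _))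
    where
    value : Dec (Even m) → Δ₃-block (2 ^ k) m ≡ - sgn (2 ^ k) ℤ.* + (3 ^ ((m ∸ 1) / 2))
    value (yes em) = Δ₃-block-even₁₂ (2 ^ k) 1≤m em (inj₂ (2^odd%3 (odd+⇒odd m on em)))
    value (no om)  = Δ₃-block-odd₁ (2 ^ k) om (2^even%3 (odd+⇒even m on om))

  Δ₃-2^-even-even : Even (m + k) → Even m → 1 ≤ m →
    Δ₃ (2 ^ (m + k)) (2 ^ (m + k) + 2 ^ m) ≡ + (3 ^ (m / 2 ∸ 1))
  Δ₃-2^-even-even en em 1≤m = begin
    Δ₃ (2 ^ (m + k)) (2 ^ (m + k) + 2 ^ m)   ≡⟨ shift ⟩
    Δ₃-block (2 ^ k) m                       ≡⟨ Δ₃-block-even₁₂ (2 ^ k) 1≤m em (inj₁ (2^even%3 (even+⇒even m en em))) ⟩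
    - sgn (2 ^ k) ℤ.* + (3 ^ ((m ∸ 1) / 2))  ≡⟨ -sgn[2^k]* k (+ (3 ^ ((m ∸ 1) / 2))) ⟩
    + (3 ^ ((m ∸ 1) / 2))                    ≡⟨ cong (λ e → + (3 ^ e)) (even⇒[m∸1]/2≡m/2∸1 1≤m em) ⟩
    + (3 ^ (m / 2 ∸ 1))                      ∎
    where open ≡-Reasoning

  -- Here `k` is odd as well, which is the vanishing case of residue 2.
  Δ₃-2^-even-odd : Even (m + k) → Odd m → Δ₃ (2 ^ (m + k)) (2 ^ (m + k) + 2 ^ m) ≡ 0ℤ
  Δ₃-2^-even-odd en om = trans shift (Δ₃-block-odd₂ (2 ^ k) om (2^odd%3 (even+⇒odd m en om)))

module _ (m i : ℕ) where

  private
    a : ℕ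
    a = 2 ^ (2 + (m + i)) + 2 ^ (m + i)

    shift : Δ₃ a (a + 2 ^ m) ≡ Δ₃-block (5 * 2 ^ i) m
    shift = Δ₃≡block (5 * 2 ^ i) m (2^[2+m+i]+2^[m+i] m i)

    -- As 5 ≡ -1 modulo 3, the factor 5 swaps the residues 1 and 2 of the power of 2. The roles of
    -- even and odd `n` are therefore exchanged relative to intervals starting at `2 ^ n`.
    odd⇒1 : Odd i → 5 * 2 ^ i % 3 ≡ 1
    odd⇒1 o = 5*n%3 (2 ^ i) (2^odd%3 o)

    even⇒2 : Even i → 5 * 2 ^ i % 3 ≡ 2
    even⇒2 e = 5*n%3 (2 ^ i) (2^even%3 e)

  Δ₃-5·2^-even : Even (m + i) → 1 ≤ m → Δ₃ a (a + 2 ^ m) ≡ - (+ (3 ^ ((m ∸ 1) / 2)))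
  Δ₃-5·2^-even en 1≤m = trans shift (trans (value (even? m)) (-sgn[5*2^i]* i _))
    where
    value : Dec (Even m) → Δ₃-block (5 * 2 ^ i) m ≡ - sgn (5 * 2 ^ i) ℤ.* + (3 ^ ((m ∸ 1) / 2))
    value (yes em) = Δ₃-block-even₁₂ (5 * 2 ^ i) 1≤m em (inj₂ (even⇒2 (even+⇒even m en em)))
    value (no om)  = Δ₃-block-odd₁ (5 * 2 ^ i) om (odd⇒1 (even+⇒odd m en om))

  Δ₃-5·2^-odd-even : Odd (m + i) → Even m → 1 ≤ m → Δ₃ a (a + 2 ^ m) ≡ - (+ (3 ^ (m / 2 ∸ 1)))
  Δ₃-5·2^-odd-even on em 1≤m = begin
    Δ₃ a (a + 2 ^ m)                             ≡⟨ shift ⟩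
    Δ₃-block (5 * 2 ^ i) m                       ≡⟨ Δ₃-block-even₁₂ (5 * 2 ^ i) 1≤m em (inj₁ (odd⇒1 (odd+⇒odd m on em))) ⟩
    - sgn (5 * 2 ^ i) ℤ.* + (3 ^ ((m ∸ 1) / 2))  ≡⟨ -sgn[5*2^i]* i (+ (3 ^ ((m ∸ 1) / 2))) ⟩
    - (+ (3 ^ ((m ∸ 1) / 2)))                    ≡⟨ cong (λ e → - (+ (3 ^ e))) (even⇒[m∸1]/2≡m/2∸1 1≤m em) ⟩
    - (+ (3 ^ (m / 2 ∸ 1)))                      ∎
    where open ≡-Reasoning

  Δ₃-5·2^-odd-odd : Odd (m + i) → Odd m → Δ₃ a (a + 2 ^ m) ≡ 0ℤ
  Δ₃-5·2^-odd-odd on om = trans shift (Δ₃-block-odd₂ (5 * 2 ^ i) om (even⇒2 (odd+⇒even m on om)))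

-- Translating the ranges of `n` and `m`, and conclusion.

≤∸⇒+ : ∀ d n {m} → m ≤ n ∸ d → ∃ λ k → n ≡ m + k
≤∸⇒+ d n {m} m≤n∸d = n ∸ m , sym (m+[n∸m]≡n (≤-trans m≤n∸d (m∸n≤m n d)))

-- For `n` below 2 the truncated difference is 0, contradicting `1 ≤ m`. Writing `n` as
-- `2 + (m + i)` makes `n ∸ 2` reduce to `m + i`.
≤∸⇒2+ : ∀ d n {m} → 1 ≤ m → m ≤ n ∸ (2 + d) → ∃ λ i → n ≡ 2 + (m + i)
≤∸⇒2+ d (suc (suc n)) 1≤m m≤n∸d with ≤∸⇒+ d n m≤n∸d
... | i , eq = i , cong (λ x → 2 + x) eq
≤∸⇒2+ d 0 () z≤n
≤∸⇒2+ d 1 () z≤n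

even-2+ : ∀ {n} → Even (2 + n) → Even n
even-2+ e = even+⇒even 2 e (divides-refl 1)

odd-2+ : ∀ {n} → Odd (2 + n) → Odd n
odd-2+ o = odd+⇒odd 2 o (divides-refl 1)

theorem3 : (∀ (n : ℕ) → 1 ≤ n →
    (Even n → Δ₃ 0 (2 ^ n) ≡ + (2 * 3 ^ (n / 2 ∸ 1))) ×
    (Odd n → Δ₃ 0 (2 ^ n) ≡ + (3 ^ ((n ∸ 1) / 2))))
    ×
    (∀ (n m : ℕ) →
    (Odd n → 1 ≤ m → m ≤ n ∸ 1 →
    Δ₃ (2 ^ n) (2 ^ n + 2 ^ m) ≡ + (3 ^ ((m ∸ 1) / 2))) ×
    (Even n → Even m → 2 ≤ m → m ≤ n ∸ 2 →
    Δ₃ (2 ^ n) (2 ^ n + 2 ^ m) ≡ + (3 ^ (m / 2 ∸ 1))) ×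
    (Even n → Odd m → 1 ≤ m → m ≤ n ∸ 1 →
    Δ₃ (2 ^ n) (2 ^ n + 2 ^ m) ≡ + 0))
    ×
    (∀ (n m : ℕ) →
    (Even n → 1 ≤ m → m ≤ n ∸ 3 →
    Δ₃ (2 ^ n + 2 ^ (n ∸ 2)) (2 ^ n + 2 ^ (n ∸ 2) + 2 ^ m) ≡ - (+ (3 ^ ((m ∸ 1) / 2)))) ×
    (Odd n → Even m → 2 ≤ m → m ≤ n ∸ 3 →
    Δ₃ (2 ^ n + 2 ^ (n ∸ 2)) (2 ^ n + 2 ^ (n ∸ 2) + 2 ^ m) ≡ - (+ (3 ^ (m / 2 ∸ 1)))) ×
    (Odd n → Odd m → 1 ≤ m → m ≤ n ∸ 4 →
    Δ₃ (2 ^ n + 2 ^ (n ∸ 2)) (2 ^ n + 2 ^ (n ∸ 2) + 2 ^ m) ≡ + 0))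
theorem3 =
    (λ n 1≤n → Δ₃-initial-even 1≤n , Δ₃-initial-odd)
  , (λ n m → part2a n m , part2b n m , part2c n m)
  , (λ n m → part3a n m , part3b n m , part3c n m)
  where
  part2a : ∀ n m → Odd n → 1 ≤ m → m ≤ n ∸ 1 →
    Δ₃ (2 ^ n) (2 ^ n + 2 ^ m) ≡ + (3 ^ ((m ∸ 1) / 2))
  part2a n m on 1≤m m≤n∸1 with ≤∸⇒+ 1 n m≤n∸1
  ... | k , refl = Δ₃-2^-odd m k on 1≤m

  part2b : ∀ n m → Even n → Even m → 2 ≤ m → m ≤ n ∸ 2 →
    Δ₃ (2 ^ n) (2 ^ n + 2 ^ m) ≡ + (3 ^ (m / 2 ∸ 1))
  part2b n m en em 2≤m m≤n∸2 with ≤∸⇒+ 2 n m≤n∸2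
  ... | k , refl = Δ₃-2^-even-even m k en em (<⇒≤ 2≤m)

  part2c : ∀ n m → Even n → Odd m → 1 ≤ m → m ≤ n ∸ 1 →
    Δ₃ (2 ^ n) (2 ^ n + 2 ^ m) ≡ + 0
  part2c n m en om _ m≤n∸1 with ≤∸⇒+ 1 n m≤n∸1
  ... | k , refl = Δ₃-2^-even-odd m k en om

  part3a : ∀ n m → Even n → 1 ≤ m → m ≤ n ∸ 3 →
    Δ₃ (2 ^ n + 2 ^ (n ∸ 2)) (2 ^ n + 2 ^ (n ∸ 2) + 2 ^ m) ≡ - (+ (3 ^ ((m ∸ 1) / 2)))
  part3a n m en 1≤m m≤n∸3 with ≤∸⇒2+ 1 n 1≤m m≤n∸3
  ... | i , refl = Δ₃-5·2^-even m i (even-2+ en) 1≤m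

  part3b : ∀ n m → Odd n → Even m → 2 ≤ m → m ≤ n ∸ 3 →
    Δ₃ (2 ^ n + 2 ^ (n ∸ 2)) (2 ^ n + 2 ^ (n ∸ 2) + 2 ^ m) ≡ - (+ (3 ^ (m / 2 ∸ 1)))
  part3b n m on em 2≤m m≤n∸3 with ≤∸⇒2+ 1 n (<⇒≤ 2≤m) m≤n∸3
  ... | i , refl = Δ₃-5·2^-odd-even m i (odd-2+ on) em (<⇒≤ 2≤m)

  part3c : ∀ n m → Odd n → Odd m → 1 ≤ m → m ≤ n ∸ 4 →
    Δ₃ (2 ^ n + 2 ^ (n ∸ 2)) (2 ^ n + 2 ^ (n ∸ 2) + 2 ^ m) ≡ + 0
  part3c n m on om 1≤m m≤n∸4 with ≤∸⇒2+ 2 n 1≤m m≤n∸4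
  ... | i , refl = Δ₃-5·2^-odd-odd m i (odd-2+ on) om
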